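{- A connected graph $G$ with order $n$ satisfies $\mathrm{vp}(G) = n-1$ if and only if $G$ contains a universal vertex, whilst $\mathrm{vp}^-(G) = n-1$ if and only if $G$ is a complete graph.
   Context: All graphs are finite, undirected and simple. A universal vertex is a vertex adjacent to all other vertices. A $u,v$-geodesic is a shortest $u,v$-path. For a vertex $x$ of $G$, a set $S \subseteq V(G)$ is an $x$-position set if for every $y \in S$ no vertex of $S \setminus \{y\}$ lies on any $x,y$-geodesic in $G$. The $x$-position number $p_x(G)$ is the maximum cardinality of an $x$-position set of $G$. Define $\mathrm{vp}(G) = \max_{x \in V(G)} p_x(G)$ and $\mathrm{vp}^-(G) = \min_{x \in V(G)} p_x(G)$.
   Formalization: The order n is assumed to be at least 2: for the one-vertex graph the statement fails, since there vp = vp⁻ = 1 rather than n − 1 = 0, although that graph is complete and its vertex is vacuously universal. -}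

module Defs where

open import Level using (0ℓ)
open import Data.Nat.Base using (ℕ; zero; suc; _≤_; _<_; NonZero)
open import Data.Nat.Properties as ℕ using (anyUpTo?; allUpTo?)
open import Data.Fin.Base using (Fin; zero; suc)
open import Data.Fin.Properties as Fin using (any?; all?; injective⇒≤)
open import Data.Fin.Subset using (Subset; _∈_; _-_; ∣_∣; ⊥)
open import Data.Fin.Subset.Properties using (_∈?_; anySubset?; ∣p∣≤n; ∉⊥)
open import Data.List.Base using (List; []; _∷_; length; lookup)
open import Data.List.Membership.Propositional using () renaming (_∈_ to _∈ˡ_; _∉_ to _∉ˡ_)
open import Data.List.Membership.Propositional.Properties using (∈-lookup)
open import Data.List.Relation.Unary.All as All using ()
open import Data.List.Relation.Unary.AllPairs using ([]; _∷_)
open import Data.List.Relation.Unary.Unique.Propositional using (Unique)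
open import Data.Product.Base using (∃; ∃-syntax; _×_; _,_; proj₁)
open import Data.Sum.Base using (_⊎_; inj₁; inj₂)
open import Function.Base using (_∘_)
open import Relation.Binary.Core using (Rel)
open import Relation.Binary.Construct.Closure.ReflexiveTransitive using (Star; ε; _◅_)
open import Relation.Binary.Definitions using (Symmetric) renaming (Decidable to Decidable₂)
open import Relation.Binary.PropositionalEquality using (_≡_; _≢_; refl; sym; cong; subst)
open import Relation.Nullary using (¬_; Dec; yes; no; contradiction; ¬?; _×-dec_; _→-dec_; map′)
open import Relation.Unary using (Pred; Decidable)

IsMaximum : Pred ℕ 0ℓ → ℕ → Set
IsMaximum P m = P m × (∀ {k} → P k → k ≤ m)

IsMinimum : Pred ℕ 0ℓ → ℕ → Set
IsMinimum P m = P m × (∀ {k} → P k → m ≤ k)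

maximum : {P : Pred ℕ 0ℓ} → Decidable P → ∃ P →
          ∀ b → (∀ {k} → P k → k ≤ b) → ∃ (IsMaximum P)
maximum {P} P? (k , Pk) zero bound =
  0 , subst P (ℕ.n≤0⇒n≡0 (bound Pk)) Pk , bound
maximum {P} P? e (suc b) bound with P? (suc b)
... | yes P1+b = suc b , P1+b , bound
... | no ¬P1+b = maximum P? e b λ Pk →
  ℕ.≤-pred (ℕ.≤∧≢⇒< (bound Pk) (λ k≡1+b → ¬P1+b (subst P k≡1+b Pk)))

minimum : {P : Pred ℕ 0ℓ} → Decidable P → ∃ P → ∃ (IsMinimum P)
minimum {P} P? (k , Pk) with search (suc k)
  where
  search : ∀ b → ∃ (IsMinimum P) ⊎ (∀ {j} → j < b → ¬ P j)
  search zero = inj₂ λ ()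
  search (suc b) with search b
  ... | inj₁ min = inj₁ min
  ... | inj₂ none with P? b
  ...   | yes Pb = inj₁ (b , Pb , λ Pj → ℕ.≮⇒≥ (λ j<b → none j<b Pj))
  ...   | no ¬Pb = inj₂ λ {j} j<1+b Pj →
          none (ℕ.≤∧≢⇒< (ℕ.≤-pred j<1+b) (λ j≡b → ¬Pb (subst P j≡b Pj))) Pj
... | inj₁ min  = min
... | inj₂ none = contradiction Pk (none (ℕ.n<1+n k))

-- Every relation on a finite set is classically decidable, so adj? restricts
-- nothing; it is what allows vp and vp⁻ below to be defined as numbers.
record Graph (n : ℕ) : Set₁ where
  field
    Adj     : Rel (Fin n) 0ℓ
    adj?    : Decidable₂ Adj
    adj-sym : Symmetric Adj
    irrefl  : ∀ {u} → ¬ Adj u u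

module _ {n : ℕ} (G : Graph n) where
  open Graph G

  IsUniversal : Fin n → Set
  IsUniversal u = ∀ v → v ≢ u → Adj u v

  IsComplete : Set
  IsComplete = ∀ u v → u ≢ v → Adj u v

  Walk : Fin n → Fin n → Set
  Walk = Star Adj

  len : ∀ {u v} → Walk u v → ℕ
  len ε       = 0
  len (_ ◅ p) = suc (len p)

  vertices : ∀ {u v} → Walk u v → List (Fin n)
  vertices {u} ε       = u ∷ []
  vertices {u} (_ ◅ p) = u ∷ vertices p

  IsPath : ∀ {u v} → Walk u v → Set
  IsPath p = Unique (vertices p)

  Connected : Set
  Connected = ∀ u v → ∃[ p ] IsPath {u} {v} p

  IsGeodesic : ∀ {u v} → Walk u v → Set
  IsGeodesic {u} {v} p = IsPath p × (∀ (q : Walk u v) → IsPath q → len p ≤ len q)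

  -- S - y is S with the element y removed.  The set S may contain x, but then
  -- nothing else, as x lies on every x,y-geodesic (in a connected graph).
  IsPositionSet : Fin n → Subset n → Set
  IsPositionSet x S =
    ∀ y → y ∈ S → ∀ z → z ∈ S - y →
    ∀ (p : Walk x y) → IsGeodesic p → z ∉ˡ vertices p

  PositionSetSize : Fin n → ℕ → Set
  PositionSetSize x k = ∃[ S ] IsPositionSet x S × ∣ S ∣ ≡ k

  -- Geodesics have fewer than n edges, so a bounded search decides whether
  -- IsPositionSet holds.
  private
    lookup-injective : {xs : List (Fin n)} → Unique xs →
                       ∀ {i j} → lookup xs i ≡ lookup xs j → i ≡ j
    lookup-injective (_  ∷ _) {zero}  {zero}  _  = refl
    lookup-injective (x≢ ∷ _) {zero}  {suc j} eq =
      contradiction eq (All.lookup x≢ (∈-lookup j))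
    lookup-injective (x≢ ∷ _) {suc i} {zero}  eq =
      contradiction (sym eq) (All.lookup x≢ (∈-lookup i))
    lookup-injective (_  ∷ u) {suc i} {suc j} eq = cong suc (lookup-injective u eq)

    length-vertices : ∀ {u v} (p : Walk u v) → length (vertices p) ≡ suc (len p)
    length-vertices ε       = refl
    length-vertices (_ ◅ p) = cong suc (length-vertices p)

    path-len<n : ∀ {u v} (p : Walk u v) → IsPath p → len p < n
    path-len<n p path =
      subst (_≤ n) (length-vertices p) (injective⇒≤ (lookup-injective path))

    WalkOfLength : (List (Fin n) → Set) → ℕ → Fin n → Fin n → Set
    WalkOfLength Q k u v = ∃[ p ] len {u} {v} p ≡ k × Q (vertices p)

    walkOfLength? : ∀ {Q} → Decidable Q → ∀ k u v → Dec (WalkOfLength Q k u v)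
    walkOfLength? {Q} Q? zero u v with u Fin.≟ v
    ... | no u≢v   = no λ { (ε , _) → u≢v refl ; ((_ ◅ _) , () , _) }
    ... | yes refl = map′ (λ q → ε , refl , q)
                          (λ { (ε , _ , q) → q ; ((_ ◅ _) , () , _) })
                          (Q? (u ∷ []))
    walkOfLength? {Q} Q? (suc k) u v =
      map′ (λ { (w , a , p , refl , q) → (a ◅ p) , refl , q })
           (λ { (ε , () , _) ; ((a ◅ p) , refl , q) → _ , a , p , refl , q })
           (any? λ w → adj? u w ×-dec walkOfLength? (Q? ∘ (u ∷_)) k w v)

    open import Data.List.Relation.Unary.Unique.DecPropositional (Fin._≟_ {n})
      using (unique?)
    open import Data.List.Membership.DecPropositional (Fin._≟_ {n})
      using () renaming (_∈?_ to _∈ˡ?_)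

    GeodesicThrough : Fin n → Fin n → Fin n → Set
    GeodesicThrough x y z = ∃[ p ] IsGeodesic {x} {y} p × z ∈ˡ vertices p

    geodesicThrough? : ∀ x y z → Dec (GeodesicThrough x y z)
    geodesicThrough? x y z = map′ to from
      (anyUpTo? (λ k → walkOfLength? (λ vs → unique? vs ×-dec (z ∈ˡ? vs)) k x y
                       ×-dec allUpTo? (λ j → ¬? (walkOfLength? unique? j x y)) k) n)
      where
      Short : Set
      Short = ∃[ k ] k < n
            × WalkOfLength (λ vs → Unique vs × z ∈ˡ vs) k x y
            × (∀ {j} → j < k → ¬ WalkOfLength Unique j x y)

      to : Short → GeodesicThrough x y z
      to (_ , _ , (p , refl , path , z∈p) , none) =
        p , (path , λ q q-path → ℕ.≮⇒≥ (λ q<p → none q<p (q , refl , q-path))) , z∈p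

      from : GeodesicThrough x y z → Short
      from (p , (path , shortest) , z∈p) =
        len p , path-len<n p path , (p , refl , path , z∈p) ,
        λ { j<p (q , refl , q-path) → ℕ.<⇒≱ j<p (shortest q q-path) }

  isPositionSet? : ∀ x → Decidable (IsPositionSet x)
  isPositionSet? x S =
    map′ (λ f y y∈S z z∈S-y p geo z∈p → f y y∈S z z∈S-y (p , geo , z∈p))
         (λ f y y∈S z z∈S-y (p , geo , z∈p) → f y y∈S z z∈S-y p geo z∈p)
         (all? λ y → (y ∈? S) →-dec
          all? λ z → (z ∈? (S - y)) →-dec ¬? (geodesicThrough? x y z))

  positionSetSize? : ∀ x → Decidable (PositionSetSize x)
  positionSetSize? x k = anySubset? λ S → isPositionSet? x S ×-dec (∣ S ∣ ℕ.≟ k)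

  maxPositionSetSize : ∀ x → ∃ (IsMaximum (PositionSetSize x))
  maxPositionSetSize x = maximum (positionSetSize? x)
    (_ , ⊥ , (λ _ y∈⊥ → contradiction y∈⊥ ∉⊥) , refl)
    n (λ { (S , _ , refl) → ∣p∣≤n S })

  positionNumber : Fin n → ℕ
  positionNumber x = proj₁ (maxPositionSetSize x)

  IsPositionNumber : ℕ → Set
  IsPositionNumber k = ∃[ x ] positionNumber x ≡ k

  isPositionNumber? : Decidable IsPositionNumber
  isPositionNumber? k = any? λ x → positionNumber x ℕ.≟ k

  positionNumber≤n : ∀ x → positionNumber x ≤ n
  positionNumber≤n x with maxPositionSetSize x
  ... | _ , (S , _ , refl) , _ = ∣p∣≤n S

module _ {n : ℕ} .{{_ : NonZero n}} (G : Graph n) where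

  private
    somePositionNumber : ∃ (IsPositionNumber G)
    somePositionNumber = _ , someVertex n , refl
      where
      someVertex : ∀ n .{{_ : NonZero n}} → Fin n
      someVertex (suc _) = zero

  -- The maximum and minimum over all vertices; NonZero n ensures there is one.
  maxPositionNumber : ∃ (IsMaximum (IsPositionNumber G))
  maxPositionNumber = maximum (isPositionNumber? G) somePositionNumber
    n (λ { (x , refl) → positionNumber≤n G x })

  minPositionNumber : ∃ (IsMinimum (IsPositionNumber G))
  minPositionNumber = minimum (isPositionNumber? G) somePositionNumber

  vp : ℕ
  vp = proj₁ maxPositionNumber

  vp⁻ : ℕ
  vp⁻ = proj₁ minPositionNumber

{-# OPTIONS --safe #-}

-- A position set at x cannot contain both y and another vertex of an
-- x,y-geodesic.  As n ≥ 2, it therefore misses a vertex, and if it misses only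
-- one then no x,v-geodesic has an inner vertex w: two of x, v, w would lie in
-- it.  Hence p_x ≤ n - 1, with equality exactly when x is universal.

module Submission where

open import Data.Empty using (⊥)
open import Data.Fin.Base using (Fin; zero; suc)
open import Data.Fin.Subset using (Subset; _∈_; _∉_; _-_; ∣_∣; ∁; ⁅_⁆; ⊤; inside; outside)
open import Data.Fin.Subset.Properties
  using (_∈?_; ∈⊤; ∣⊤∣≡n; ∣∁p∣≡n∸∣p∣; ∣⁅x⁆∣≡1; x∈⁅x⁆; x∈∁p⇒x∉p; p─q⊆p;
         ⊆⊤; p⊂q⇒∣p∣<∣q∣; x∈p∧x≢y⇒x∈p-y; drop-there)
open import Data.List.Membership.Propositional using () renaming (_∈_ to _∈ˡ_)
open import Data.List.Relation.Unary.All as All using ([]; _∷_)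
open import Data.List.Relation.Unary.AllPairs using ([]; _∷_)
open import Data.List.Relation.Unary.Any using (here; there)
open import Data.Nat.Base using (ℕ; suc; _≤_; _<_; _∸_; NonZero; s≤s)
open import Data.Nat.Induction using (<-rec)
open import Data.Nat.Properties as ℕ using ()
open import Data.Product.Base using (∃; ∃-syntax; _×_; _,_; proj₁; proj₂)
open import Data.Vec.Base using (_∷_)
open import Function.Base using (_∘_)
open import Function.Bundles using (_⇔_; mk⇔)
open import Relation.Binary.Construct.Closure.ReflexiveTransitive using (ε; _◅_)
open import Relation.Binary.PropositionalEquality
  using (_≡_; _≢_; refl; sym; trans; cong; subst; ≢-sym)
open import Relation.Nullary using (¬_; yes; no; decidable-stable)
open import Defs

another : ∀ {n} → 2 ≤ n → (x : Fin n) → ∃[ y ] y ≢ x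
another (s≤s (s≤s _)) zero    = suc zero , λ ()
another (s≤s (s≤s _)) (suc _) = zero , λ ()

x∉p-x : ∀ {n} (p : Subset n) x → x ∉ p - x
x∉p-x (inside  ∷ _) zero    ()
x∉p-x (outside ∷ _) zero    ()
x∉p-x (_       ∷ p) (suc x) = x∉p-x p x ∘ drop-there

x∉p⇒∣p∣<n : ∀ {n} {x : Fin n} {p} → x ∉ p → ∣ p ∣ < n
x∉p⇒∣p∣<n {n} {x} {p} x∉p = subst (∣ p ∣ <_) (∣⊤∣≡n n)
  (p⊂q⇒∣p∣<∣q∣ {p = p} {⊤} (⊆⊤ , x , ∈⊤ , x∉p))

-- The inclusions of `p` in `⊤ - x` and of `⊤ - x` in `⊤` are both strict, witnessed by `y` and by
-- `x`.
x,y∉p⇒1+∣p∣<n : ∀ {n} {x y : Fin n} {p} → x ≢ y → x ∉ p → y ∉ p → suc ∣ p ∣ < n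
x,y∉p⇒1+∣p∣<n {x = x} {y} {p} x≢y x∉p y∉p = ℕ.≤-<-trans
  (p⊂q⇒∣p∣<∣q∣ {p = p} {⊤ - x}
    ((λ z∈p → x∈p∧x≢y⇒x∈p-y ∈⊤ λ { refl → x∉p z∈p }) ,
     y , x∈p∧x≢y⇒x∈p-y ∈⊤ (≢-sym x≢y) , y∉p))
  (x∉p⇒∣p∣<n (x∉p-x ⊤ x))

module _ {n : ℕ} (G : Graph n) where
  open Graph G

  source∈vertices : ∀ {u v} (p : Walk G u v) → u ∈ˡ vertices G p
  source∈vertices ε       = here refl
  source∈vertices (_ ◅ _) = here refl

  -- The double negation is harmless, as adjacency is decidable.
  path⇒¬¬geodesic : ∀ {u v} (p : Walk G u v) → IsPath G p →
                    ¬ ¬ (∃[ q ] IsGeodesic G {u} {v} q)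
  path⇒¬¬geodesic {u} {v} p p-path ¬geodesic = noPath (len G p) p refl p-path
    where
    NoPath : ℕ → Set
    NoPath k = (q : Walk G u v) → len G q ≡ k → ¬ IsPath G q

    noPath : ∀ k → NoPath k
    -- Strong induction on length: once all shorter paths are excluded, `q` would be a geodesic.
    noPath = <-rec NoPath λ { _ shorter q refl q-path →
      ¬geodesic (q , q-path , λ r r-path →
        ℕ.≮⇒≥ λ r<q → shorter r<q r refl r-path) }

  -- The edge from `x` to `y` is a path of length 1, so a geodesic between them contains only `x`
  -- and `y`, and `z` is neither.
  universal⇒positionSet : ∀ {x} → IsUniversal G x → IsPositionSet G x (∁ ⁅ x ⁆)
  universal⇒positionSet {x} univ y y∈S z z∈S-y p (_ , shortest) z∈p =
    onlyEnds p (shortest (univ y y≢x ◅ ε) ((≢-sym y≢x ∷ []) ∷ [] ∷ [])) z∈p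
    where
    y≢x : y ≢ x
    y≢x refl = x∈∁p⇒x∉p y∈S (x∈⁅x⁆ x)

    z≢x : z ≢ x
    z≢x refl = x∈∁p⇒x∉p (p─q⊆p (∁ ⁅ x ⁆) ⁅ y ⁆ z∈S-y) (x∈⁅x⁆ x)

    z≢y : z ≢ y
    z≢y refl = x∉p-x (∁ ⁅ x ⁆) y z∈S-y

    onlyEnds : (p : Walk G x y) → len G p ≤ 1 → ¬ (z ∈ˡ vertices G p)
    onlyEnds ε           _        (here z≡x)         = z≢x z≡x
    onlyEnds (_ ◅ ε)     _        (here z≡x)         = z≢x z≡x
    onlyEnds (_ ◅ ε)     _        (there (here z≡y)) = z≢y z≡y
    onlyEnds (_ ◅ _ ◅ _) (s≤s ()) _

  module _ (connected : Connected G) where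

    ¬¬geodesic : ∀ u v → ¬ ¬ (∃[ p ] IsGeodesic G {u} {v} p)
    ¬¬geodesic u v with p , p-path ← connected u v = path⇒¬¬geodesic p p-path

    onGeodesic⇒∉positionSet : ∀ {x y z S} → IsPositionSet G x S →
      (p : Walk G x y) → IsGeodesic G p → z ∈ˡ vertices G p → z ≢ y →
      y ∈ S → z ∉ S
    onGeodesic⇒∉positionSet pos p geo z∈p z≢y y∈S z∈S =
      pos _ y∈S _ (x∈p∧x≢y⇒x∈p-y z∈S z≢y) p geo z∈p

    -- Every geodesic from `x` contains `x`, so `x` itself is the forbidden vertex on a geodesic to
    -- `y`.
    x∈positionSet⇒others∉ : ∀ {x y S} → IsPositionSet G x S →
                            x ∈ S → x ≢ y → y ∉ S
    x∈positionSet⇒others∉ {x} {y} pos x∈S x≢y y∈S =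
      ¬¬geodesic x y λ { (p , geo) →
        onGeodesic⇒∉positionSet pos p geo (source∈vertices p) x≢y y∈S x∈S }

    -- The vertex outside `S` is `x`, or any other vertex if `x ∈ S`. For `n = 1` the singleton of
    -- `x` would be a position set with `n` elements.
    ∣positionSet∣<n : 2 ≤ n → ∀ {x S} → IsPositionSet G x S → ∣ S ∣ < n
    ∣positionSet∣<n 2≤n {x} {S} pos with x ∈? S
    ... | no x∉S  = x∉p⇒∣p∣<n x∉S
    ... | yes x∈S with y , y≢x ← another 2≤n x =
      x∉p⇒∣p∣<n (x∈positionSet⇒others∉ pos x∈S (≢-sym y≢x))

    -- By `large`, `S` misses at most one vertex. If `v` were not adjacent to `x`, a geodesic to `v`
    -- would have a second vertex `w` distinct from both, and two of `x`, `v`, `w` would be outside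
    -- `S`.
    largePositionSet⇒universal : ∀ {x S} → IsPositionSet G x S →
                                 n ≤ suc ∣ S ∣ → IsUniversal G x
    largePositionSet⇒universal {x} {S} pos large v v≢x =
      decidable-stable (adj? x v) λ ¬x~v →
        ¬¬geodesic x v λ { (p , geo) → noInnerVertex ¬x~v p geo }
      where
      notBothMissing : ∀ {a b} → a ≢ b → a ∉ S → b ∉ S → ⊥
      notBothMissing a≢b a∉S b∉S = ℕ.<⇒≱ (x,y∉p⇒1+∣p∣<n a≢b a∉S b∉S) large

      noInnerVertex : ¬ Adj x v → (p : Walk G x v) → ¬ IsGeodesic G p
      noInnerVertex _    ε       _ = v≢x refl
      -- Here `x≢`, from the path condition, says that `x` differs from all later vertices, in
      -- particular from `w`.
      noInnerVertex ¬x~v (_◅_ {j = w} x~w p) geo@((x≢ ∷ _) , _) with x ∈? S | v ∈? S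
      ... | yes x∈S | _ =
        notBothMissing (≢-sym w≢v)
          (x∈positionSet⇒others∉ pos x∈S (≢-sym v≢x))
          (x∈positionSet⇒others∉ pos x∈S (All.lookup x≢ (source∈vertices p)))
        where
        w≢v : w ≢ v
        w≢v refl = ¬x~v x~w
      ... | no x∉S | no v∉S = notBothMissing (≢-sym v≢x) x∉S v∉S
      -- As `w` is on a geodesic to `v ∈ S`, it is outside `S`, and so is `x`.
      ... | no x∉S | yes v∈S =
        notBothMissing (All.lookup x≢ (source∈vertices p)) x∉S
          (onGeodesic⇒∉positionSet pos (x~w ◅ p) geo
            (there (source∈vertices p)) (λ { refl → ¬x~v x~w }) v∈S)

    module _ (2≤n : 2 ≤ n) where

      positionNumber≤n∸1 : ∀ x → positionNumber G x ≤ n ∸ 1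
      positionNumber≤n∸1 x
        with _ , pos , ∣S∣≡ ← proj₁ (proj₂ (maxPositionSetSize G x)) =
        subst (_≤ n ∸ 1) ∣S∣≡ (ℕ.<⇒≤pred (∣positionSet∣<n 2≤n pos))

      universal⇒positionNumber≡n∸1 : ∀ {x} → IsUniversal G x →
                                     positionNumber G x ≡ n ∸ 1
      universal⇒positionNumber≡n∸1 {x} univ = ℕ.≤-antisym (positionNumber≤n∸1 x)
        (proj₂ (proj₂ (maxPositionSetSize G x))
          (∁ ⁅ x ⁆ , universal⇒positionSet univ ,
           trans (∣∁p∣≡n∸∣p∣ ⁅ x ⁆) (cong (n ∸_) (∣⁅x⁆∣≡1 x))))

      -- An inequality suffices, because a position set of maximum size then misses at most one
      -- vertex. This form fits `vp⁻`, which bounds every position number from below.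
      n∸1≤positionNumber⇒universal : ∀ {x} → n ∸ 1 ≤ positionNumber G x →
                                     IsUniversal G x
      n∸1≤positionNumber⇒universal {x} n∸1≤
        with _ , pos , ∣S∣≡ ← proj₁ (proj₂ (maxPositionSetSize G x)) =
        largePositionSet⇒universal pos
          (ℕ.≤-trans (ℕ.m≤n+m∸n n 1) (s≤s (subst (n ∸ 1 ≤_) (sym ∣S∣≡) n∸1≤)))

corollary4p1 : ∀ (n : ℕ) .{{_ : NonZero n}} → 2 ≤ n → (G : Graph n) → Connected G →
    (vp G ≡ n ∸ 1 ⇔ ∃ (IsUniversal G)) × (vp⁻ G ≡ n ∸ 1 ⇔ IsComplete G)
corollary4p1 n 2≤n G connected =
  mk⇔ vp≡⇒universal universal⇒vp≡ , mk⇔ vp⁻≡⇒complete complete⇒vp⁻≡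
  where
  vp≡⇒universal : vp G ≡ n ∸ 1 → ∃ (IsUniversal G)
  -- A vertex attaining the maximum is the universal one.
  vp≡⇒universal vp≡ with x , px≡vp ← proj₁ (proj₂ (maxPositionNumber G)) =
    x , n∸1≤positionNumber⇒universal G connected 2≤n
          (ℕ.≤-reflexive (sym (trans px≡vp vp≡)))

  universal⇒vp≡ : ∃ (IsUniversal G) → vp G ≡ n ∸ 1
  universal⇒vp≡ (x , univ)
    with (y , py≡vp) , vp-max ← proj₂ (maxPositionNumber G) = ℕ.≤-antisym
    (subst (_≤ n ∸ 1) py≡vp (positionNumber≤n∸1 G connected 2≤n y))
    (vp-max (x , universal⇒positionNumber≡n∸1 G connected 2≤n univ))

  vp⁻≡⇒complete : vp⁻ G ≡ n ∸ 1 → IsComplete G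
  vp⁻≡⇒complete vp⁻≡ u v u≢v = n∸1≤positionNumber⇒universal G connected 2≤n
    (subst (_≤ positionNumber G u) vp⁻≡ (proj₂ (proj₂ (minPositionNumber G)) (u , refl)))
    v (≢-sym u≢v)

  complete⇒vp⁻≡ : IsComplete G → vp⁻ G ≡ n ∸ 1
  -- The minimum is attained at some `x`, which completeness makes universal.
  complete⇒vp⁻≡ complete with x , px≡vp⁻ ← proj₁ (proj₂ (minPositionNumber G)) =
    trans (sym px≡vp⁻) (universal⇒positionNumber≡n∸1 G connected 2≤n
      λ v v≢x → complete x v (≢-sym v≢x))
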